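{- Let $a\in\mathbb R$ with $a\ne0$ and let $q$ be a non-degenerate quadratic form over $\mathbb R$ of signature $(r_+,r_-)$. Then $$\omega(\mathcal G_{q,a})=\begin{cases}r_++1,&\text{if }a>0,\\ r_-+1,&\text{if }a<0.\end{cases}$$
   Context: The form $q$ is on a finite-dimensional real vector space $V$. The signature $(r_+,r_-)$ records the numbers of positive and negative entries in a diagonalization of $q$. $\mathcal G_{q,a}$ is the graph with vertex set $V$ and edge set $\{\{x,y\}\mid x\ne y,\ q(x-y)=a\}$; $\omega$ denotes the clique number (size of a largest clique). -}

module Defs where

open import Level using (Level; _⊔_; suc)
open import Algebra.Bundles using (CommutativeRing)
open import Algebra.Module.Bundles using (Module)
import Algebra.Definitions.RawMonoid as RawMonoidDefs
import Algebra.Properties.AbelianGroup as AbelianGroupProperties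
import Algebra.Properties.Ring as RingProperties
import Algebra.Module.Properties.LeftModule as LeftModuleProperties
open import Data.Fin.Base using (Fin)
open import Data.Nat.Base as ℕ using (ℕ)
open import Data.Product.Base using (_×_; _,_; ∃; ∃-syntax)
open import Data.Vec.Base using (count; tabulate)
open import Function.Definitions using (Injective)
open import Relation.Binary.Bundles using (Setoid)
open import Relation.Binary.Core using (Rel)
open import Relation.Binary.PropositionalEquality.Core using (_≡_; _≢_)
open import Relation.Binary.Structures using (IsStrictTotalOrder)
import Relation.Binary.Construct.StrictToNonStrict as StrictToNonStrict
open import Relation.Binary.Definitions using (Symmetric; Irreflexive; _Respects₂_)
open import Relation.Nullary.Negation.Core using (¬_)
open import Relation.Unary using (Pred; Satisfiable)

-- ℝ is characterised, up to unique isomorphism, as the Dedekind-complete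
-- ordered field. The trichotomy in IsStrictTotalOrder and the suprema of
-- arbitrary predicates are the classical properties of ℝ: they are part of
-- the structure, so no separate excluded-middle assumption is made.
record CompleteOrderedField c ℓ₁ ℓ₂ : Set (suc (c ⊔ ℓ₁ ⊔ ℓ₂)) where
  infix 4 _<_
  field
    commutativeRing : CommutativeRing c ℓ₁

  open CommutativeRing commutativeRing public

  field
    _<_                : Rel Carrier ℓ₂
    isStrictTotalOrder : IsStrictTotalOrder _≈_ _<_

  open IsStrictTotalOrder isStrictTotalOrder public
    using (_<?_; compare; <-resp-≈)
    renaming (_≟_ to _≈?_; trans to <-trans; irrefl to <-irrefl; asym to <-asym)
  open StrictToNonStrict _≈_ _<_ public using (_≤_)

  IsUpperBound : ∀ {p} → Pred Carrier p → Carrier → Set (c ⊔ ℓ₁ ⊔ ℓ₂ ⊔ p)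
  IsUpperBound P b = ∀ x → P x → x ≤ b

  IsSupremum : ∀ {p} → Pred Carrier p → Carrier → Set (c ⊔ ℓ₁ ⊔ ℓ₂ ⊔ p)
  IsSupremum P s = IsUpperBound P s × (∀ b → IsUpperBound P b → s ≤ b)

  field
    0<1      : 0# < 1#
    inverse  : ∀ x → x ≉ 0# → ∃[ y ] x * y ≈ 1#
    +-mono-< : ∀ x y z → x < y → x + z < y + z
    *-pos    : ∀ x y → 0# < x → 0# < y → 0# < x * y
    supremum : (P : Pred Carrier (c ⊔ ℓ₁ ⊔ ℓ₂)) →
               Satisfiable P → ∃ (IsUpperBound P) → ∃ (IsSupremum P)

-- Carries no finiteness condition; see FiniteDimensional.
VectorSpace : ∀ {c ℓ₁ ℓ₂} → CompleteOrderedField c ℓ₁ ℓ₂ →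
              ∀ m ℓm → Set (c ⊔ ℓ₁ ⊔ suc (m ⊔ ℓm))
VectorSpace ℝ m ℓm = Module (CompleteOrderedField.commutativeRing ℝ) m ℓm

module _ {c ℓ₁ ℓ₂ m ℓm} (ℝ : CompleteOrderedField c ℓ₁ ℓ₂)
         (V : VectorSpace ℝ m ℓm) where

  open CompleteOrderedField ℝ
  open Module V
  open RawMonoidDefs +ᴹ-rawMonoid using () renaming (sum to sumᴹ)
  open RawMonoidDefs +-rawMonoid using (sum)

  linearCombination : ∀ {n} → (Fin n → Carrier) → (Fin n → Carrierᴹ) → Carrierᴹ
  linearCombination x e = sumᴹ (λ i → x i *ₗ e i)

  record IsBasis {n} (e : Fin n → Carrierᴹ) : Set (c ⊔ ℓ₁ ⊔ m ⊔ ℓm) where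
    field
      spanning    : ∀ v → ∃[ x ] linearCombination x e ≈ᴹ v
      independent : ∀ x → linearCombination x e ≈ᴹ 0ᴹ → ∀ i → x i ≈ 0#

  FiniteDimensional : Set (c ⊔ ℓ₁ ⊔ m ⊔ ℓm)
  FiniteDimensional = ∃[ n ] ∃[ e ] IsBasis {n} e

  record QuadraticForm : Set (c ⊔ ℓ₁ ⊔ m ⊔ ℓm) where
    field
      ⟦_⟧     : Carrierᴹ → Carrier
      ⟦⟧-cong : ∀ {u v} → u ≈ᴹ v → ⟦ u ⟧ ≈ ⟦ v ⟧

    polar : Carrierᴹ → Carrierᴹ → Carrier
    polar u v = ⟦ u +ᴹ v ⟧ - ⟦ u ⟧ - ⟦ v ⟧

    -- polar is symmetric, so linearity in one argument makes it bilinear.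
    field
      homogeneous : ∀ t v → ⟦ t *ₗ v ⟧ ≈ t * t * ⟦ v ⟧
      polar-+     : ∀ u v w → polar (u +ᴹ v) w ≈ polar u w + polar v w
      polar-*     : ∀ t u v → polar (t *ₗ u) v ≈ t * polar u v

  module _ (q : QuadraticForm) where
    open QuadraticForm q

    NonDegenerate : Set (ℓ₁ ⊔ m ⊔ ℓm)
    NonDegenerate = ∀ u → (∀ v → polar u v ≈ 0#) → u ≈ᴹ 0ᴹ

    IsDiagonalization : ∀ {n} → (Fin n → Carrierᴹ) → (Fin n → Carrier) →
                        Set (c ⊔ ℓ₁ ⊔ m ⊔ ℓm)
    IsDiagonalization e d =
      IsBasis e × (∀ x → ⟦ linearCombination x e ⟧ ≈ sum (λ i → d i * (x i * x i)))

    HasSignature : ℕ → ℕ → Set (c ⊔ ℓ₁ ⊔ m ⊔ ℓm)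
    HasSignature r₊ r₋ =
      ∃[ n ] ∃[ e ] ∃[ d ] IsDiagonalization {n} e d
        × count (λ x → 0# <? x) (tabulate d) ≡ r₊
        × count (λ x → x <? 0#) (tabulate d) ≡ r₋

record Graph v ℓ e : Set (suc (v ⊔ ℓ ⊔ e)) where
  field
    vertices : Setoid v ℓ

  open Setoid vertices public renaming (Carrier to Vertex)

  field
    Adjacent        : Rel Vertex e
    Adjacent-resp-≈ : Adjacent Respects₂ _≈_
    Adjacent-sym    : Symmetric Adjacent
    Adjacent-irrefl : Irreflexive _≈_ Adjacent

module _ {v ℓ e} (G : Graph v ℓ e) where
  open Graph G

  -- A clique of size k, given by an enumeration of its k distinct vertices.
  record Clique (k : ℕ) : Set (v ⊔ ℓ ⊔ e) where
    field
      vertex   : Fin k → Vertex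
      distinct : Injective _≡_ _≈_ vertex
      adjacent : ∀ i j → i ≢ j → Adjacent (vertex i) (vertex j)

  -- The bound also excludes infinite cliques, since these contain finite
  -- cliques of every size.
  IsCliqueNumber : ℕ → Set (v ⊔ ℓ ⊔ e)
  IsCliqueNumber k = Clique k × (∀ n → Clique n → n ℕ.≤ k)

module _ {c ℓ₁ ℓ₂ m ℓm} (ℝ : CompleteOrderedField c ℓ₁ ℓ₂)
         (V : VectorSpace ℝ m ℓm) (q : QuadraticForm ℝ V)
         (a : CompleteOrderedField.Carrier ℝ) where

  open CompleteOrderedField ℝ
  open Module V
  open QuadraticForm q

  private
    module M = AbelianGroupProperties +ᴹ-abelianGroup
    module R = RingProperties ring

    -1*ₗ≈-ᴹ : ∀ v → (- 1#) *ₗ v ≈ᴹ -ᴹ v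
    -1*ₗ≈-ᴹ v = LeftModuleProperties.inverseʳ-uniqueᴹ leftModule v _
      (≈ᴹ-trans (+ᴹ-congʳ (≈ᴹ-sym (*ₗ-identityˡ v)))
      (≈ᴹ-trans (≈ᴹ-sym (*ₗ-distribʳ v 1# (- 1#)))
      (≈ᴹ-trans (*ₗ-congʳ (-‿inverseʳ 1#)) (*ₗ-zeroˡ v))))

    -1*-1 : - 1# * - 1# ≈ 1#
    -1*-1 = trans (R.-1*x≈-x (- 1#)) (R.-‿involutive 1#)

    even : ∀ v → ⟦ -ᴹ v ⟧ ≈ ⟦ v ⟧
    even v = trans (⟦⟧-cong (≈ᴹ-sym (-1*ₗ≈-ᴹ v)))
      (trans (homogeneous (- 1#) v) (trans (*-congʳ -1*-1) (*-identityˡ _)))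

    swap : ∀ x y → -ᴹ (x +ᴹ -ᴹ y) ≈ᴹ y +ᴹ -ᴹ x
    swap x y = ≈ᴹ-trans (M.⁻¹-anti-homo-∙ x (-ᴹ y)) (+ᴹ-congʳ (M.⁻¹-involutive y))

  𝒢 : Graph m ℓm (ℓ₁ ⊔ ℓm)
  𝒢 = record
    { vertices        = ≈ᴹ-setoid
    ; Adjacent        = λ x y → x ≉ᴹ y × ⟦ x +ᴹ -ᴹ y ⟧ ≈ a
    ; Adjacent-resp-≈ =
        (λ y≈z (x≉y , p) → (λ x≈z → x≉y (≈ᴹ-trans x≈z (≈ᴹ-sym y≈z)))
                         , trans (⟦⟧-cong (+ᴹ-congˡ (-ᴹ‿cong (≈ᴹ-sym y≈z)))) p)
      , (λ y≈z (y≉x , p) → (λ z≈x → y≉x (≈ᴹ-trans y≈z z≈x))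
                         , trans (⟦⟧-cong (+ᴹ-congʳ (≈ᴹ-sym y≈z))) p)
    ; Adjacent-sym    = λ {x} {y} (x≉y , p) →
        (λ y≈x → x≉y (≈ᴹ-sym y≈x))
      , trans (⟦⟧-cong (≈ᴹ-sym (swap x y))) (trans (even (x +ᴹ -ᴹ y)) p)
    ; Adjacent-irrefl = λ x≈y (x≉y , _) → x≉y x≈y
    }

{-# OPTIONS --safe #-}

-- In coordinates diagonalizing q, write Q(x) = Σ dₗ xₗ². If C₁, …, C_k are
-- pairwise at Q-distance a, then 2 Q(Σ xᵢ Cᵢ) = a Σ xᵢ² whenever Σ xᵢ = 0. If
-- k > r + 1, where r of the dₗ have the sign of a, then some x ≠ 0 with Σ xᵢ = 0
-- makes the r corresponding coordinates of Σ xᵢ Cᵢ vanish, so that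
-- a Q(Σ xᵢ Cᵢ) ≤ 0, a contradiction. Conversely, a regular simplex in ℝʳ,
-- formed by the standard basis and a multiple of (1, …, 1), is mapped to a
-- clique by rescaling these r coordinates by the square roots of a / 2dₗ.
module Submission where

open import Level using (Level; _⊔_; Lift; lift)
open import Algebra.Bundles using (CommutativeMonoid; CommutativeRing)
open import Algebra.Module.Bundles using (Module)
import Algebra.Module.Properties.LeftModule as LeftModuleProperties
import Algebra.Properties.AbelianGroup as AbelianGroupProperties
import Algebra.Properties.CommutativeSemigroup as CommutativeSemigroupProperties
import Algebra.Properties.Ring as RingProperties
import Algebra.Properties.Semiring.Mult.TCOptimised as Mult
import Algebra.Properties.Semiring.Sum as Sum
import Algebra.Solver.Ring
open import Algebra.Solver.Ring.AlmostCommutativeRing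
  using (fromCommutativeRing; _-Raw-AlmostCommutative⟶_)
open import Data.Fin.Base using (Fin; zero; suc; punchIn; punchOut)
open import Data.Fin.Properties using (any?; punchIn-punchOut) renaming (_≟_ to _≟ᶠ_)
open import Data.Integer.Base as ℤ using (ℤ; +_; -[1+_]; _⊖_; _◃_)
import Data.Integer.Properties as ℤ
open import Data.Maybe.Base using (Maybe; just; nothing)
open import Data.Nat.Base as ℕ using (ℕ; zero; suc; s≤s)
import Data.Nat.Properties as ℕ
open import Data.Product.Base using (_×_; _,_; proj₁; proj₂; ∃; ∃-syntax; Σ-syntax)
import Data.Sign.Base as Sign
open import Data.Sum.Base using (inj₁; inj₂)
open import Data.Vec.Base using (count; tabulate)
open import Data.Vec.Functional using (_∷_)
open import Function.Base using (_∘_)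
import Relation.Binary.Construct.StrictToNonStrict as NonStrict
open import Relation.Binary.Definitions using (tri<; tri≈; tri>)
open import Relation.Binary.PropositionalEquality as ≡ using (_≡_; _≢_)
import Relation.Binary.Reasoning.Setoid as SetoidReasoning
open import Relation.Nullary using (yes; no; ¬_; contradiction; ¬?)
open import Relation.Nullary.Decidable using (decidable-stable)
open import Relation.Unary using (Pred; Decidable)
open import Defs

-- Integers in a commutative ring, and the ring solver built on them.

-- With coefficients in the abstract R, whose equality does not compute, the
-- solver could not cancel x − x; hence the coefficients in ℤ.
module IntegerSolver {c ℓ} (R : CommutativeRing c ℓ) where
  open CommutativeRing R
  open RingProperties ring using (-0#≈0#; -‿+-comm; -‿involutive; -‿distribˡ-*; -‿distribʳ-*)
  open Mult semiring using (1+×; ×1-homo-*; ×-homo-+) renaming (_×_ to _·_)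
  open SetoidReasoning setoid

  private
    ⟦_⟧ : ℤ → Carrier
    ⟦ + n ⟧      = n · 1#
    ⟦ -[1+ n ] ⟧ = - (suc n · 1#)

    cancel : ∀ x y z → (x + y) - (x + z) ≈ y - z
    cancel x y z = begin
      (x + y) - (x + z)       ≈⟨ +-congˡ (-‿+-comm x z) ⟨
      (x + y) + (- x + - z)   ≈⟨ +-congʳ (+-comm x y) ⟩
      (y + x) + (- x + - z)   ≈⟨ +-assoc y x _ ⟩
      y + (x + (- x + - z))   ≈⟨ +-congˡ (+-assoc x (- x) (- z)) ⟨
      y + ((x - x) + - z)     ≈⟨ +-congˡ (+-congʳ (-‿inverseʳ x)) ⟩
      y + (0# + - z)          ≈⟨ +-congˡ (+-identityˡ (- z)) ⟩
      y - z                   ∎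

    ⊖-homo : ∀ m n → ⟦ m ⊖ n ⟧ ≈ m · 1# - n · 1#
    ⊖-homo m       zero    = sym (trans (+-congˡ -0#≈0#) (+-identityʳ _))
    ⊖-homo zero    (suc n) = sym (+-identityˡ _)
    ⊖-homo (suc m) (suc n) = begin
      ⟦ suc m ⊖ suc n ⟧                 ≡⟨ ≡.cong ⟦_⟧ (ℤ.[1+m]⊖[1+n]≡m⊖n m n) ⟩
      ⟦ m ⊖ n ⟧                         ≈⟨ ⊖-homo m n ⟩
      m · 1# - n · 1#                   ≈⟨ cancel 1# _ _ ⟨
      (1# + m · 1#) - (1# + n · 1#)     ≈⟨ +-cong (1+× m 1#) (-‿cong (1+× n 1#)) ⟨
      suc m · 1# - suc n · 1#           ∎

    +-homo : ∀ i j → ⟦ i ℤ.+ j ⟧ ≈ ⟦ i ⟧ + ⟦ j ⟧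
    +-homo (+ m)      (+ n)      = ×-homo-+ 1# m n
    +-homo (+ m)      (-[1+ n ]) = ⊖-homo m (suc n)
    +-homo (-[1+ m ]) (+ n)      = trans (⊖-homo n (suc m)) (+-comm _ _)
    +-homo (-[1+ m ]) (-[1+ n ]) = begin
      - (suc (suc (m ℕ.+ n)) · 1#)       ≡⟨ ≡.cong (λ k → ⟦ -[1+ k ] ⟧) (≡.sym (ℕ.+-suc m n)) ⟩
      - ((suc m ℕ.+ suc n) · 1#)         ≈⟨ -‿cong (×-homo-+ 1# (suc m) (suc n)) ⟩
      - (suc m · 1# + suc n · 1#)        ≈⟨ -‿+-comm _ _ ⟨
      - (suc m · 1#) - (suc n · 1#)      ∎

    +◃-homo : ∀ n → ⟦ Sign.+ ◃ n ⟧ ≈ n · 1#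
    +◃-homo zero    = refl
    +◃-homo (suc n) = refl

    -◃-homo : ∀ n → ⟦ Sign.- ◃ n ⟧ ≈ - (n · 1#)
    -◃-homo zero    = sym -0#≈0#
    -◃-homo (suc n) = refl

    *-homo : ∀ i j → ⟦ i ℤ.* j ⟧ ≈ ⟦ i ⟧ * ⟦ j ⟧
    *-homo (+ m)      (+ n)      = trans (+◃-homo (m ℕ.* n)) (×1-homo-* m n)
    *-homo (+ m)      (-[1+ n ]) = trans (-◃-homo (m ℕ.* suc n))
      (trans (-‿cong (×1-homo-* m (suc n))) (-‿distribʳ-* _ _))
    *-homo (-[1+ m ]) (+ n)      = trans (-◃-homo (suc m ℕ.* n))
      (trans (-‿cong (×1-homo-* (suc m) n)) (-‿distribˡ-* _ _))
    *-homo (-[1+ m ]) (-[1+ n ]) = begin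
      (suc m ℕ.* suc n) · 1#              ≈⟨ ×1-homo-* (suc m) (suc n) ⟩
      (suc m · 1#) * (suc n · 1#)         ≈⟨ -‿involutive _ ⟨
      - - ((suc m · 1#) * (suc n · 1#))   ≈⟨ -‿cong (-‿distribʳ-* _ _) ⟩
      - ((suc m · 1#) * - (suc n · 1#))   ≈⟨ -‿distribˡ-* _ _ ⟩
      - (suc m · 1#) * - (suc n · 1#)     ∎

    -‿homo : ∀ i → ⟦ ℤ.- i ⟧ ≈ - ⟦ i ⟧
    -‿homo (+ zero)   = sym -0#≈0#
    -‿homo (+ suc n)  = refl
    -‿homo (-[1+ n ]) = sym (-‿involutive _)

    homomorphism : ℤ.+-*-rawRing -Raw-AlmostCommutative⟶ fromCommutativeRing R
    homomorphism = record
      { ⟦_⟧ = ⟦_⟧ ; +-homo = +-homo ; *-homo = *-homo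
      ; -‿homo = -‿homo ; 0-homo = refl ; 1-homo = refl }

    coefficient≟ : ∀ i j → Maybe (⟦ i ⟧ ≈ ⟦ j ⟧)
    coefficient≟ i j with i ℤ.≟ j
    ... | yes i≡j = just (reflexive (≡.cong ⟦_⟧ i≡j))
    ... | no  _   = nothing

  open Algebra.Solver.Ring ℤ.+-*-rawRing (fromCommutativeRing R) homomorphism coefficient≟ public

-- Order and signs in a complete ordered field.

module OrderedField {c ℓ₁ ℓ₂} (ℝ : CompleteOrderedField c ℓ₁ ℓ₂) where
  open CompleteOrderedField ℝ
  open IntegerSolver commutativeRing
    using (solve; con; _:=_; _:+_; _:*_; _:-_; :-_)

  <-respʳ-≈ : ∀ {x y z} → y ≈ z → x < y → x < z
  <-respʳ-≈ = proj₁ <-resp-≈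

  <-respˡ-≈ : ∀ {x y z} → y ≈ z → y < x → z < x
  <-respˡ-≈ = proj₂ <-resp-≈

  ≤-respʳ-≈ : ∀ {x y z} → y ≈ z → x ≤ y → x ≤ z
  ≤-respʳ-≈ = NonStrict.≤-respʳ-≈ _≈_ _<_ trans <-respʳ-≈

  ≤-trans : ∀ {x y z} → x ≤ y → y ≤ z → x ≤ z
  ≤-trans = NonStrict.trans _≈_ _<_ isEquivalence <-resp-≈ <-trans

  ≤⇒≯ : ∀ {x y} → x ≤ y → ¬ y < x
  ≤⇒≯ (inj₁ x<y) y<x = <-asym x<y y<x
  ≤⇒≯ (inj₂ x≈y) y<x = <-irrefl (sym x≈y) y<x

  ≮⇒≥ : ∀ {x y} → ¬ x < y → y ≤ x
  ≮⇒≥ {x} {y} x≮y with compare x y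
  ... | tri< x<y _ _ = contradiction x<y x≮y
  ... | tri≈ _ x≈y _ = inj₂ (sym x≈y)
  ... | tri> _ _ y<x = inj₁ y<x

  0<y-x⇒x<y : ∀ {x y} → 0# < y - x → x < y
  0<y-x⇒x<y {x} {y} 0<y-x =
    <-respˡ-≈ (+-identityˡ x)
      (<-respʳ-≈ (solve 2 (λ x y → (y :- x) :+ x := y) refl x y)
        (+-mono-< 0# (y - x) x 0<y-x))

  x<y⇒0<y-x : ∀ {x y} → x < y → 0# < y - x
  x<y⇒0<y-x {x} {y} x<y = <-respˡ-≈ (-‿inverseʳ x) (+-mono-< x y (- x) x<y)

  x≤y⇒0≤y-x : ∀ {x y} → x ≤ y → 0# ≤ y - x
  x≤y⇒0≤y-x         (inj₁ x<y) = inj₁ (x<y⇒0<y-x x<y)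
  x≤y⇒0≤y-x {x} {y} (inj₂ x≈y) = inj₂ (sym (trans (+-congˡ (-‿cong x≈y)) (-‿inverseʳ y)))

  0≤y-x⇒x≤y : ∀ {x y} → 0# ≤ y - x → x ≤ y
  0≤y-x⇒x≤y (inj₁ 0<y-x) = inj₁ (0<y-x⇒x<y 0<y-x)
  0≤y-x⇒x≤y {x} {y} (inj₂ 0≈y-x) = inj₂
    (trans (sym (+-identityˡ x)) (trans (+-congʳ 0≈y-x)
      (solve 2 (λ x y → (y :- x) :+ x := y) refl x y)))

  x<0⇒0<-x : ∀ {x} → x < 0# → 0# < - x
  x<0⇒0<-x x<0 = <-respʳ-≈ (+-identityˡ _) (x<y⇒0<y-x x<0)

  pos⇒≉0 : ∀ {x} → 0# < x → x ≉ 0#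
  pos⇒≉0 0<x x≈0 = <-irrefl (sym x≈0) 0<x

  +-pos-nonneg : ∀ {x y} → 0# < x → 0# ≤ y → 0# < x + y
  +-pos-nonneg {x} {y} 0<x (inj₁ 0<y) =
    <-trans 0<y (<-respˡ-≈ (+-identityˡ y) (+-mono-< 0# x y 0<x))
  +-pos-nonneg {x} {y} 0<x (inj₂ 0≈y) =
    <-respʳ-≈ (trans (sym (+-identityʳ x)) (+-congˡ 0≈y)) 0<x

  +-nonneg : ∀ {x y} → 0# ≤ x → 0# ≤ y → 0# ≤ x + y
  +-nonneg         (inj₁ 0<x) 0≤y = inj₁ (+-pos-nonneg 0<x 0≤y)
  +-nonneg {x} {y} (inj₂ 0≈x) 0≤y =
    ≤-respʳ-≈ (trans (sym (+-identityˡ y)) (+-congʳ 0≈x)) 0≤y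

  *-nonneg : ∀ {x y} → 0# ≤ x → 0# ≤ y → 0# ≤ x * y
  *-nonneg (inj₁ 0<x) (inj₁ 0<y) = inj₁ (*-pos _ _ 0<x 0<y)
  *-nonneg (inj₁ 0<x) (inj₂ 0≈y) = inj₂ (sym (trans (*-congˡ (sym 0≈y)) (zeroʳ _)))
  *-nonneg (inj₂ 0≈x) _          = inj₂ (sym (trans (*-congʳ (sym 0≈x)) (zeroˡ _)))

  *-neg-neg : ∀ {x y} → x < 0# → y < 0# → 0# < x * y
  *-neg-neg {x} {y} x<0 y<0 =
    <-respʳ-≈ (solve 2 (λ x y → :- x :* :- y := x :* y) refl x y)
      (*-pos _ _ (x<0⇒0<-x x<0) (x<0⇒0<-x y<0))

  *-nonneg-nonpos : ∀ {x y} → 0# ≤ x → y ≤ 0# → x * y ≤ 0#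
  *-nonneg-nonpos {x} {y} 0≤x y≤0 = 0≤y-x⇒x≤y (≤-respʳ-≈
    (solve 2 (λ x y → x :* (con (+ 0) :- y) := con (+ 0) :- x :* y) refl x y)
    (*-nonneg 0≤x (x≤y⇒0≤y-x y≤0)))

  *-neg-nonneg : ∀ {x y} → x < 0# → 0# ≤ y → x * y ≤ 0#
  *-neg-nonneg {x} {y} x<0 0≤y = 0≤y-x⇒x≤y (≤-respʳ-≈
    (solve 2 (λ x y → (con (+ 0) :- x) :* y := con (+ 0) :- x :* y) refl x y)
    (*-nonneg (x≤y⇒0≤y-x (inj₁ x<0)) 0≤y))

  square-pos : ∀ {x} → x ≉ 0# → 0# < x * x
  square-pos {x} x≉0 with compare x 0#
  ... | tri< x<0 _ _ = *-neg-neg x<0 x<0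
  ... | tri≈ _ x≈0 _ = contradiction x≈0 x≉0
  ... | tri> _ _ 0<x = *-pos x x 0<x 0<x

  square-nonneg : ∀ x → 0# ≤ x * x
  square-nonneg x with x ≈? 0#
  ... | yes x≈0 = inj₂ (sym (trans (*-congʳ x≈0) (zeroˡ x)))
  ... | no  x≉0 = inj₁ (square-pos x≉0)

  inverse-pos : ∀ {x y} → 0# < x → x * y ≈ 1# → 0# < y
  inverse-pos {x} {y} 0<x xy≈1 with compare y 0#
  ... | tri> _ _ 0<y = 0<y
  ... | tri≈ _ y≈0 _ = contradiction
    (trans (sym xy≈1) (trans (*-congˡ y≈0) (zeroʳ x))) (pos⇒≉0 0<1)
  ... | tri< y<0 _ _ = contradiction 0<1 (<-asym (0<y-x⇒x<y
    (<-respʳ-≈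
      (trans (solve 2 (λ x y → x :* :- y := con (+ 0) :- x :* y) refl x y) (+-congˡ (-‿cong xy≈1)))
      (*-pos _ _ 0<x (x<0⇒0<-x y<0)))))

  -- By contraposition: if `y < x`, then `x² - y²` is the product of `x - y` and `x + y`. Writing
  -- the second factor as `(x - y) + 2y` shows that it is positive.
  square-cancel-≤ : ∀ {x y} → 0# ≤ y → x * x ≤ y * y → x ≤ y
  square-cancel-≤ {x} {y} 0≤y x²≤y² = ≮⇒≥ λ y<x → ≤⇒≯ x²≤y² (0<y-x⇒x<y
    (<-respʳ-≈ (solve 2 (λ x y → (x :- y) :* ((x :- y) :+ (y :+ y)) := x :* x :- y :* y) refl x y)
      (*-pos _ _ (x<y⇒0<y-x y<x) (+-pos-nonneg (x<y⇒0<y-x y<x) (+-nonneg 0≤y 0≤y)))))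

  -- Square roots of nonnegative elements, from suprema.

  private
    -- One step s ↦ t = (s k + x) u from s towards √x, where u = 1/(s + k).
    -- If k² > x it does not pass √x.
    module Step (s k u x : Carrier) ([s+k]u≈1 : (s + k) * u ≈ 1#) where
      t : Carrier
      t = (s * k + x) * u

      t-s : t - s ≈ (x - s * s) * u
      -- The relation `(s + k) * u ≈ 1#` is used by inserting its left side as a factor; what
      -- remains is a polynomial identity. In `t²-x` the square of this factor is inserted in the
      -- same way.
      t-s = trans (+-congˡ (-‿cong (sym (trans (*-congˡ [s+k]u≈1) (*-identityʳ s)))))
        (solve 4 (λ s k u x → (s :* k :+ x) :* u :- s :* ((s :+ k) :* u)
                              := (x :- s :* s) :* u) refl s k u x)

      s-t : s - t ≈ (s * s - x) * u
      s-t = trans (solve 2 (λ s t → s :- t := :- (t :- s)) refl s t) (trans (-‿cong t-s)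
        (solve 3 (λ s u x → :- ((x :- s :* s) :* u) := (s :* s :- x) :* u) refl s u x))

      t²-x : t * t - x ≈ (k * k - x) * (s * s - x) * (u * u)
      t²-x = trans
        (+-congˡ (-‿cong (sym (trans
          (*-congˡ (trans (*-cong [s+k]u≈1 [s+k]u≈1) (*-identityˡ 1#))) (*-identityʳ x)))))
        (solve 4 (λ s k u x →
          ((s :* k :+ x) :* u) :* ((s :* k :+ x) :* u) :- x :* (((s :+ k) :* u) :* ((s :+ k) :* u))
            := (k :* k :- x) :* (s :* s :- x) :* (u :* u)) refl s k u x)

      x-t² : x - t * t ≈ (k * k - x) * (x - s * s) * (u * u)
      x-t² = trans (solve 2 (λ x y → x :- y := :- (y :- x)) refl x (t * t)) (trans (-‿cong t²-x)
        (solve 4 (λ K y u x → :- (K :* (y :- x) :* u) := K :* (x :- y) :* u) refl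
          (k * k - x) (s * s) (u * u) x))

    -- The difference is `1 + x + x²`. The lemma serves twice: it makes `1 + x` an upper bound of
    -- `Below x`, and it admits `k = 1 + x` in `Step`.
    x<[1+x]² : ∀ {x} → 0# ≤ x → x < (1# + x) * (1# + x)
    x<[1+x]² {x} 0≤x = 0<y-x⇒x<y (<-respʳ-≈
      (solve 1 (λ x → (con (+ 1) :+ x) :+ x :* x
                      := (con (+ 1) :+ x) :* (con (+ 1) :+ x) :- x) refl x)
      (+-pos-nonneg (+-pos-nonneg 0<1 0≤x) (square-nonneg x)))

    -- Negative `y` are allowed; since 0 belongs to the set when `0 ≤ x`, its supremum is still
    -- nonnegative. `Lift` only brings the predicate to the universe level that `supremum` expects.
    Below : Carrier → Carrier → Set (c ⊔ ℓ₁ ⊔ ℓ₂)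
    Below x y = Lift c (y * y ≤ x)

    0∈Below : ∀ {x} → 0# ≤ x → Below x 0#
    0∈Below 0≤x = lift (≤-trans (inj₂ (zeroˡ 0#)) 0≤x)

    module _ {x s k u : Carrier} (0≤x : 0# ≤ x) (0≤s : 0# ≤ s) (0<k : 0# < k) (0<u : 0# < u)
             (x<k² : x < k * k) ([s+k]u≈1 : (s + k) * u ≈ 1#) where
      open Step s k u x [s+k]u≈1

      0≤t : 0# ≤ t
      0≤t = *-nonneg (+-nonneg (*-nonneg 0≤s (inj₁ 0<k)) 0≤x) (inj₁ 0<u)

      improve-below : s * s < x → ∃[ t ] s < t × t * t < x
      improve-below s²<x = t
        , 0<y-x⇒x<y (<-respʳ-≈ (sym t-s) (*-pos _ _ (x<y⇒0<y-x s²<x) 0<u))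
        , 0<y-x⇒x<y (<-respʳ-≈ (sym x-t²)
            (*-pos _ _ (*-pos _ _ (x<y⇒0<y-x x<k²) (x<y⇒0<y-x s²<x)) (*-pos _ _ 0<u 0<u)))

      improve-above : x < s * s → ∃[ t ] 0# ≤ t × t < s × x < t * t
      improve-above x<s² = t , 0≤t
        , 0<y-x⇒x<y (<-respʳ-≈ (sym s-t) (*-pos _ _ (x<y⇒0<y-x x<s²) 0<u))
        , 0<y-x⇒x<y (<-respʳ-≈ (sym t²-x)
            (*-pos _ _ (*-pos _ _ (x<y⇒0<y-x x<k²) (x<y⇒0<y-x x<s²)) (*-pos _ _ 0<u 0<u)))

    -- If `s² < x`, a step from `s` reaches a larger element of `Below x`, so `s` is no upper bound.
    -- If `x < s²`, a step reaches a smaller nonnegative `t` with `x < t²`, which is still an upper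
    -- bound, so `s` is not the least one.
    sup-square : ∀ {x s} → 0# ≤ x → IsSupremum (Below x) s → s * s ≈ x
    sup-square {x} {s} 0≤x (upper , least) = go (inverse (s + k) (pos⇒≉0 0<s+k))
      where
      k : Carrier
      k = 1# + x

      0<k : 0# < k
      0<k = +-pos-nonneg 0<1 0≤x

      0≤s : 0# ≤ s
      0≤s = upper 0# (0∈Below 0≤x)

      0<s+k : 0# < s + k
      0<s+k = <-respʳ-≈ (+-comm k s) (+-pos-nonneg 0<k 0≤s)

      go : ∃[ u ] (s + k) * u ≈ 1# → s * s ≈ x
      go (u , [s+k]u≈1) with compare (s * s) x
      ... | tri≈ _ s²≈x _ = s²≈x
      ... | tri< s²<x _ _ =
        let t , s<t , t²<x = improve-below 0≤x 0≤s 0<k (inverse-pos 0<s+k [s+k]u≈1)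
                               (x<[1+x]² 0≤x) [s+k]u≈1 s²<x
        in contradiction s<t (≤⇒≯ (upper t (lift (inj₁ t²<x))))
      ... | tri> _ _ x<s² =
        let t , 0≤t , t<s , x<t² = improve-above 0≤x 0≤s 0<k (inverse-pos 0<s+k [s+k]u≈1)
                                     (x<[1+x]² 0≤x) [s+k]u≈1 x<s²
        in contradiction t<s (≤⇒≯ (least t λ y (lift y²≤x) →
             square-cancel-≤ 0≤t (≤-trans y²≤x (inj₁ x<t²))))

  sqrt : ∀ {x} → 0# ≤ x → ∃[ s ] 0# ≤ s × s * s ≈ x
  sqrt {x} 0≤x =
    let bound     = λ y (lift y²≤x) → square-cancel-≤ (inj₁ (+-pos-nonneg 0<1 0≤x))
                      (≤-trans y²≤x (inj₁ (x<[1+x]² 0≤x)))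
        s , s-sup = supremum (Below x) (0# , 0∈Below 0≤x) (1# + x , bound)
    in s , proj₁ s-sup 0# (0∈Below 0≤x) , sup-square 0≤x s-sup

-- Diagonal bilinear forms and equidistant families in coordinates.

module Coordinates {c ℓ} (R : CommutativeRing c ℓ) where
  open CommutativeRing R hiding (zero)
  open IntegerSolver R using (solve; con; _:=_; _:+_; _:*_; _:-_; :-_)
  open Sum semiring using (sum; sum-cong-≋; ∑-distrib-+; ∑-comm; *-distribˡ-sum; *-distribʳ-sum)
  open SetoidReasoning setoid

  _⊝_ : ∀ {n} → (Fin n → Carrier) → (Fin n → Carrier) → Fin n → Carrier
  (x ⊝ y) l = x l - y l

  form : ∀ {n} (d x y : Fin n → Carrier) → Carrier
  form d x y = sum (λ l → d l * (x l * y l))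

  form-sym : ∀ {n} (d x y : Fin n → Carrier) → form d x y ≈ form d y x
  form-sym d x y = sum-cong-≋ λ l → *-congˡ (*-comm (x l) (y l))

  form-⊝ : ∀ {n} (d x y : Fin n → Carrier) →
           form d (x ⊝ y) (x ⊝ y) ≈ form d x x + form d y y - (form d x y + form d x y)
  form-⊝ {zero}  d x y =
    solve 0 (con (+ 0) := con (+ 0) :+ con (+ 0) :- (con (+ 0) :+ con (+ 0))) refl
  form-⊝ {suc n} d x y = trans (+-congˡ (form-⊝ (d ∘ suc) (x ∘ suc) (y ∘ suc)))
    (solve 6 (λ d x y X Y XY →
      d :* ((x :- y) :* (x :- y)) :+ (X :+ Y :- (XY :+ XY)) :=
      (d :* (x :* x) :+ X) :+ (d :* (y :* y) :+ Y)
        :- ((d :* (x :* y) :+ XY) :+ (d :* (x :* y) :+ XY)))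
      refl (d zero) (x zero) (y zero) _ _ _)

  form-sumʳ : ∀ {n k} (d u : Fin n → Carrier) (x : Fin k → Carrier) (C : Fin k → Fin n → Carrier) →
              form d u (λ l → sum (λ i → x i * C i l)) ≈ sum (λ i → x i * form d u (C i))
  form-sumʳ {n} {k} d u x C = begin
    sum (λ l → d l * (u l * sum (λ i → x i * C i l)))
      ≈⟨ sum-cong-≋ (λ l → trans (sym (*-assoc _ _ _)) (trans (*-distribˡ-sum {k} (d l * u l) _)
           (sum-cong-≋ λ i → solve 4 (λ d u x y → (d :* u) :* (x :* y) := x :* (d :* (u :* y))) refl
             (d l) (u l) (x i) (C i l)))) ⟩
    sum (λ l → sum (λ i → x i * (d l * (u l * C i l))))
      ≈⟨ ∑-comm (λ l i → x i * (d l * (u l * C i l))) ⟩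
    sum (λ i → sum (λ l → x i * (d l * (u l * C i l))))
      ≈⟨ sum-cong-≋ (λ i → *-distribˡ-sum {n} (x i) _) ⟨
    sum (λ i → x i * form d u (C i)) ∎

  -- Besides being the Kronecker symbol, `δ i` is the `i`-th standard basis vector. The recursion on
  -- both indices matches the recursion of `sum`.
  δ : ∀ {n} → Fin n → Fin n → Carrier
  δ zero    zero    = 1#
  δ zero    (suc j) = 0#
  δ (suc i) zero    = 0#
  δ (suc i) (suc j) = δ i j

  δ-refl : ∀ {n} (i : Fin n) → δ i i ≈ 1#
  δ-refl zero    = refl
  δ-refl (suc i) = δ-refl i

  δ-≢ : ∀ {n} {i j : Fin n} → i ≢ j → δ i j ≈ 0#
  δ-≢ {i = zero}  {zero}  i≢j = contradiction ≡.refl i≢j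
  δ-≢ {i = zero}  {suc j} _   = refl
  δ-≢ {i = suc i} {zero}  _   = refl
  δ-≢ {i = suc i} {suc j} i≢j = δ-≢ (i≢j ∘ ≡.cong suc)

  sum-0* : ∀ {n} (x : Fin n → Carrier) → sum (λ i → 0# * x i) ≈ 0#
  sum-0* x = trans (sym (*-distribˡ-sum 0# x)) (zeroˡ _)

  sum-δ : ∀ {n} (i : Fin n) (x : Fin n → Carrier) → sum (λ j → δ i j * x j) ≈ x i
  sum-δ zero    x = trans (+-cong (*-identityˡ _) (sum-0* (x ∘ suc))) (+-identityʳ _)
  sum-δ (suc i) x = trans (+-cong (zeroˡ _) (sum-δ i (x ∘ suc))) (+-identityˡ _)

  -- Expanding the form along z = Σ xᵢ Cᵢ, the terms Q(Cᵢ) + Q(Cⱼ) of twice the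
  -- Gram matrix are killed by Σ xᵢ = 0, and only the diagonal part a δ is left.
  form-equidistant :
    ∀ {n k} (d : Fin n → Carrier) (a : Carrier) (x : Fin k → Carrier)
    (C : Fin k → Fin n → Carrier) →
    (∀ i j → i ≢ j → form d (C i ⊝ C j) (C i ⊝ C j) ≈ a) → sum x ≈ 0# →
    let z = λ l → sum (λ i → x i * C i l) in
    form d z z + form d z z ≈ a * sum (λ i → x i * x i)
  form-equidistant {k = k} d a x C equidistant Σx≈0 = begin
    form d z z + form d z z
      ≈⟨ +-cong (form-sumʳ d z x C) (form-sumʳ d z x C) ⟩
    sum (λ i → x i * form d z (C i)) + sum (λ i → x i * form d z (C i))
      ≈⟨ ∑-distrib-+ {k} _ _ ⟨
    sum (λ i → x i * form d z (C i) + x i * form d z (C i))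
      ≈⟨ sum-cong-≋ (λ i → trans (sym (distribˡ (x i) _ _)) (*-congˡ (row i))) ⟩
    sum (λ i → x i * (S + a * x i))
      ≈⟨ sum-cong-≋ (λ i → solve 3 (λ x S a → x :* (S :+ a :* x) := x :* S :+ a :* (x :* x))
           refl (x i) S a) ⟩
    sum (λ i → x i * S + a * (x i * x i))
      ≈⟨ ∑-distrib-+ {k} _ _ ⟩
    sum (λ i → x i * S) + sum (λ i → a * (x i * x i))
      ≈⟨ +-cong (trans (sym (*-distribʳ-sum S x)) (trans (*-congʳ Σx≈0) (zeroˡ S)))
           (sym (*-distribˡ-sum {k} a _)) ⟩
    0# + a * sum (λ i → x i * x i)
      ≈⟨ +-identityˡ _ ⟩
    a * sum (λ i → x i * x i) ∎
    where
    z : _ → Carrier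
    z l = sum (λ i → x i * C i l)

    Q : _ → Carrier
    Q i = form d (C i) (C i)

    S : Carrier
    S = sum (λ i → x i * Q i)

    -- The correction `a - δ i j * a` covers both cases at once: it vanishes on the diagonal, and
    -- off the diagonal it equals `a`, the distance expanded by `form-⊝`.
    gram : ∀ i j → form d (C i) (C j) + form d (C i) (C j) ≈ Q i + Q j - (a - δ i j * a)
    gram i j with i ≟ᶠ j
    ... | yes ≡.refl = trans
          (solve 2 (λ q a → q :+ q := q :+ q :- (a :- con (+ 1) :* a)) refl (Q i) a)
          (+-congˡ (-‿cong (+-congˡ (-‿cong (*-congʳ (sym (δ-refl i)))))))
    ... | no i≢j = trans
          (solve 3 (λ b p q → b :+ b := p :+ q :- (p :+ q :- (b :+ b))) refl
            (form d (C i) (C j)) (Q i) (Q j))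
          (+-congˡ (-‿cong (trans (sym (form-⊝ d (C i) (C j))) (trans (equidistant i j i≢j)
            (trans (solve 1 (λ a → a := a :- con (+ 0) :* a) refl a)
              (+-congˡ (-‿cong (*-congʳ (sym (δ-≢ i≢j))))))))))

    -- The part `Q i - a` is constant in `j` and is killed here by `Σ x = 0`, while `δ` picks out
    -- `a * x i`. The remaining `S` does not depend on `i`, so it vanishes in its turn in the outer
    -- sum.
    row : ∀ i → form d z (C i) + form d z (C i) ≈ S + a * x i
    row i = begin
      form d z (C i) + form d z (C i)
        ≈⟨ +-cong swap swap ⟩
      sum (λ j → x j * form d (C i) (C j)) + sum (λ j → x j * form d (C i) (C j))
        ≈⟨ ∑-distrib-+ {k} _ _ ⟨
      sum (λ j → x j * form d (C i) (C j) + x j * form d (C i) (C j))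
        ≈⟨ sum-cong-≋ (λ j → trans (trans (sym (distribˡ (x j) _ _)) (*-congˡ (gram i j)))
             (solve 5 (λ x p q a e →
                 x :* (p :+ q :- (a :- e :* a)) := x :* q :+ (x :* (p :- a) :+ e :* (a :* x)))
               refl (x j) (Q i) (Q j) a (δ i j))) ⟩
      sum (λ j → x j * Q j + (x j * (Q i - a) + δ i j * (a * x j)))
        ≈⟨ trans (∑-distrib-+ {k} _ _) (+-congˡ (∑-distrib-+ {k} _ _)) ⟩
      S + (sum (λ j → x j * (Q i - a)) + sum (λ j → δ i j * (a * x j)))
        ≈⟨ +-congˡ (+-cong
             (trans (sym (*-distribʳ-sum (Q i - a) x)) (trans (*-congʳ Σx≈0) (zeroˡ _)))
             (sum-δ i (λ j → a * x j))) ⟩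
      S + (0# + a * x i)
        ≈⟨ +-congˡ (+-identityˡ _) ⟩
      S + a * x i ∎
      where
      swap : form d z (C i) ≈ sum (λ j → x j * form d (C i) (C j))
      swap = trans (form-sym d z (C i)) (form-sumʳ d (C i) x C)

-- Linear dependence of more vectors than coordinates.

module Elimination {c ℓ₁ ℓ₂} (ℝ : CompleteOrderedField c ℓ₁ ℓ₂) where
  open CompleteOrderedField ℝ hiding (zero)
  open OrderedField ℝ using (pos⇒≉0)
  open Coordinates commutativeRing using (sum-0*)
  open IntegerSolver commutativeRing using (solve; con; _:=_; _:+_; _:*_; _:-_; :-_)
  open Sum semiring using (sum; sum-cong-≋; sum-replicate-zero)

  *-≉0 : ∀ {x y} → x ≉ 0# → y ≉ 0# → x * y ≉ 0#
  *-≉0 {x} {y} x≉0 y≉0 xy≈0 =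
    let x⁻¹ , xx⁻¹≈1 = inverse x x≉0 in
    y≉0 (trans (sym (trans (*-congʳ xx⁻¹≈1) (*-identityˡ y)))
      (trans (solve 3 (λ x y u → (x :* u) :* y := (x :* y) :* u) refl x y x⁻¹)
        (trans (*-congʳ xy≈0) (zeroˡ x⁻¹))))

  -- Collecting the multiples of the pivot row in a relation between reduced rows gives that row the
  -- coefficient `- Σ y b`. This turns the relation into one between the original rows.
  sum-eliminate : ∀ {k} (y b v : Fin k → Carrier) α β →
    - sum (λ i → y i * b i) * β + sum (λ i → (y i * α) * v i)
      ≈ sum (λ i → y i * (α * v i - b i * β))
  sum-eliminate {zero}  y b v α β =
    solve 1 (λ β → :- con (+ 0) :* β :+ con (+ 0) := con (+ 0)) refl β
  sum-eliminate {suc k} y b v α β = trans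
    (solve 7 (λ y b v α β S T →
        :- (y :* b :+ S) :* β :+ ((y :* α) :* v :+ T)
          := y :* (α :* v :- b :* β) :+ (:- S :* β :+ T))
      refl (y zero) (b zero) (v zero) α β _ _)
    (+-congˡ (sum-eliminate (y ∘ suc) (b ∘ suc) (v ∘ suc) α β))

  LinearlyDependent : ∀ {m k} → (Fin k → Fin m → Carrier) → Set (c ⊔ ℓ₁)
  LinearlyDependent {m} {k} w = Σ[ x ∈ (Fin k → Carrier) ]
    (∃[ i ] x i ≉ 0#) × (∀ j → sum (λ i → x i * w i j) ≈ 0#)

  -- Gaussian elimination, by induction on the number of columns. If the first row is zero, it is
  -- dependent by itself; this always happens when there are no columns. Otherwise a nonzero entry
  -- of it serves as pivot, and its row and column are removed.
  linearlyDependent : ∀ {m k} → m ℕ.< k → (w : Fin k → Fin m → Carrier) → LinearlyDependent w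
  linearlyDependent {m} {suc k} m<1+k w with any? (λ j → ¬? (w zero j ≈? 0#))
  ... | no w₀≈0 = (1# ∷ λ _ → 0#) , (zero , pos⇒≉0 0<1) , λ j → trans
    (+-cong (trans (*-identityˡ _) (decidable-stable (w zero j ≈? 0#) λ w₀j≉0 → w₀≈0 (j , w₀j≉0)))
      (sum-0* (λ i → w (suc i) j)))
    (+-identityʳ 0#)
  linearlyDependent {suc m} {suc k} (s≤s m<k) w | yes (p , α≉0) = extend (linearlyDependent m<k w′)
    where
    α : Carrier
    α = w zero p

    reduced : Fin k → Fin (suc m) → Carrier
    reduced i j = α * w (suc i) j - w (suc i) p * w zero j

    w′ : Fin k → Fin m → Carrier
    w′ i j = reduced i (punchIn p j)

    extend : LinearlyDependent w′ → LinearlyDependent w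
    extend (y , (i , yᵢ≉0) , y⊥w′) =
        (- sum (λ i → y i * w (suc i) p) ∷ λ i → y i * α)
      , (suc i , *-≉0 yᵢ≉0 α≉0)
      , λ j → trans (sum-eliminate y (λ i → w (suc i) p) (λ i → w (suc i) j) α (w zero j))
                (y⊥reduced j)
      where
      y⊥reduced : ∀ j → sum (λ i → y i * reduced i j) ≈ 0#
      -- The pivot column of `reduced` is zero by construction; every other column is a column of
      -- `w′`.
      y⊥reduced j with p ≟ᶠ j
      ... | yes ≡.refl = trans
        (sum-cong-≋ (λ i → solve 3 (λ y α b → y :* (α :* b :- b :* α) := con (+ 0))
          refl (y i) α (w (suc i) p)))
        (sum-replicate-zero k)
      ... | no p≢j = ≡.subst (λ j → sum (λ i → y i * reduced i j) ≈ 0#) (punchIn-punchOut p≢j)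
        (y⊥w′ (punchOut p≢j))

-- The bound on equidistant families, and the embedding of Euclidean space into a diagonal form.

module DiagonalForm {c ℓ₁ ℓ₂} (ℝ : CompleteOrderedField c ℓ₁ ℓ₂) where
  open CompleteOrderedField ℝ hiding (zero)
  open OrderedField ℝ
  open Coordinates commutativeRing
  open Elimination ℝ using (linearlyDependent)
  open IntegerSolver commutativeRing using (solve; con; _:=_; _:+_; _:*_; _:-_; :-_)
  open Sum semiring using (sum; sum-cong-≋)

  -- Testing the sign of `a * d l` treats `a > 0` and `a < 0` uniformly. The witness records
  -- coordinate by coordinate which entries are selected, so later proofs can recurse on it along
  -- with the sum over coordinates.
  data SameSign (a : Carrier) : ∀ {n} → (Fin n → Carrier) → ℕ → Set (c ⊔ ℓ₁ ⊔ ℓ₂) where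
    []   : {d : Fin zero → Carrier} → SameSign a d zero
    take : ∀ {n r} {d : Fin (suc n) → Carrier} →
           0# < a * d zero → SameSign a (d ∘ suc) r → SameSign a d (suc r)
    skip : ∀ {n r} {d : Fin (suc n) → Carrier} →
           a * d zero ≤ 0# → SameSign a (d ∘ suc) r → SameSign a d r

  -- Links the counts in the signature to `SameSign`; `P` will be positivity or negativity,
  -- according to the sign of `a`.
  sameSign-count : ∀ {a p} {P : Pred Carrier p} (P? : Decidable P) →
                   (∀ {x} → P x → 0# < a * x) → (∀ {x} → ¬ P x → a * x ≤ 0#) →
                   ∀ {n} (d : Fin n → Carrier) → SameSign a d (count P? (tabulate d))
  sameSign-count P? pos nonpos {zero}  d = []
  sameSign-count P? pos nonpos {suc n} d with P? (d zero) | sameSign-count P? pos nonpos (d ∘ suc)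
  ... | yes Pd₀ | s = take (pos Pd₀) s
  ... | no ¬Pd₀ | s = skip (nonpos ¬Pd₀) s

  index : ∀ {a n r} {d : Fin n → Carrier} → SameSign a d r → Fin r → Fin n
  index (take _ s) zero    = zero
  index (take _ s) (suc i) = suc (index s i)
  index (skip _ s) i       = suc (index s i)

  -- Selected coordinates of `z` contribute nothing, and every skipped one contributes
  -- `(- a d) z² ≥ 0`. Placing the sign on the right makes the induction a sum of nonnegative terms.
  form-nonpos : ∀ {a n r} {d : Fin n → Carrier} (s : SameSign a d r) (z : Fin n → Carrier) →
                (∀ i → z (index s i) ≈ 0#) → 0# ≤ - (a * form d z z)
  form-nonpos {a} [] z _ = inj₂ (solve 1 (λ a → con (+ 0) := :- (a :* con (+ 0))) refl a)
  form-nonpos {a} {d = d} (take _ s) z z≈0 = ≤-respʳ-≈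
    (-‿cong (*-congˡ (sym (trans
      (+-congʳ (trans (*-congˡ (trans (*-congʳ (z≈0 zero)) (zeroˡ _))) (zeroʳ _)))
      (+-identityˡ _)))))
    (form-nonpos s (z ∘ suc) (z≈0 ∘ suc))
  form-nonpos {a} {d = d} (skip ad₀≤0 s) z z≈0 = ≤-respʳ-≈
    (solve 4 (λ a d z F → (con (+ 0) :- a :* d) :* (z :* z) :- a :* F
        := :- (a :* (d :* (z :* z) :+ F)))
      refl a (d zero) (z zero) _)
    (+-nonneg (*-nonneg (x≤y⇒0≤y-x ad₀≤0) (square-nonneg (z zero))) (form-nonpos s (z ∘ suc) z≈0))

  sum-squares-nonneg : ∀ {k} (x : Fin k → Carrier) → 0# ≤ sum (λ i → x i * x i)
  sum-squares-nonneg {zero}  x = inj₂ refl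
  sum-squares-nonneg {suc k} x = +-nonneg (square-nonneg _) (sum-squares-nonneg (x ∘ suc))

  sum-squares-pos : ∀ {k} (x : Fin k → Carrier) {i} → x i ≉ 0# → 0# < sum (λ i → x i * x i)
  sum-squares-pos x {zero}  x₀≉0 = +-pos-nonneg (square-pos x₀≉0) (sum-squares-nonneg (x ∘ suc))
  sum-squares-pos x {suc i} xᵢ≉0 = <-respʳ-≈ (+-comm _ _)
    (+-pos-nonneg (sum-squares-pos (x ∘ suc) xᵢ≉0) (square-nonneg _))

  equidistant-bound :
    ∀ {a n r k} {d : Fin n → Carrier} → a ≉ 0# → SameSign a d r → (C : Fin k → Fin n → Carrier) →
    (∀ i j → i ≢ j → form d (C i ⊝ C j) (C i ⊝ C j) ≈ a) → ¬ suc r ℕ.< k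
  equidistant-bound {a} {r = r} {k} {d} a≉0 s C equidistant 1+r<k
    -- Each point gives a vector with `r + 1` entries: a constant 1, then its selected coordinates.
    -- In a dependence `x` between these vectors, the first entry says `Σ x = 0` and the others say
    -- that the selected coordinates of `Σ xᵢ Cᵢ` vanish.
    with linearlyDependent 1+r<k (λ i → 1# ∷ λ j → C i (index s j))
  ... | x , (i , xᵢ≉0) , x⊥ = ≤⇒≯ 0≤-aQ-aQ -aQ-aQ<0
    where
    z : _ → Carrier
    z l = sum (λ i → x i * C i l)

    Q : Carrier
    Q = form d z z

    Σx≈0 : sum x ≈ 0#
    Σx≈0 = trans (sum-cong-≋ (λ i → sym (*-identityʳ (x i)))) (x⊥ zero)

    0≤-aQ : 0# ≤ - (a * Q)
    0≤-aQ = form-nonpos s z (x⊥ ∘ suc)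

    0≤-aQ-aQ : 0# ≤ - (a * Q) - a * Q
    0≤-aQ-aQ = +-nonneg 0≤-aQ 0≤-aQ

    -- By `form-equidistant`, `a * 2Q = a² Σ xᵢ²`, which is positive because `a` and some `xᵢ` are
    -- nonzero.
    -aQ-aQ<0 : - (a * Q) - a * Q < 0#
    -aQ-aQ<0 = 0<y-x⇒x<y (<-respʳ-≈
      (trans (*-assoc a a _) (trans (*-congˡ (sym (form-equidistant d a x C equidistant Σx≈0)))
        (solve 2 (λ a q → a :* (q :+ q) := con (+ 0) :- (:- (a :* q) :- a :* q)) refl a Q)))
      (*-pos _ _ (square-pos a≉0) (sum-squares-pos x xᵢ≉0)))

  -- The witness is `t = √(2ad) / 2d`: the radicand is positive directly by the hypothesis, whatever
  -- the sign of `d`. The factor 2 compensates for the squared edge length 2 of the simplex to be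
  -- embedded.
  rescale : ∀ {a d} → 0# < a * d → ∃[ t ] (d + d) * (t * t) ≈ a
  rescale {a} {d} 0<ad =
    let 0<a[d+d]      = <-respʳ-≈ (sym (distribˡ a d d)) (+-pos-nonneg 0<ad (inj₁ 0<ad))
        s , _ , s²≈aD = sqrt (inj₁ 0<a[d+d])
        u , Du≈1      = inverse (d + d) λ D≈0 → pos⇒≉0 0<a[d+d] (trans (*-congˡ D≈0) (zeroʳ a))
    in s * u , (begin
      (d + d) * ((s * u) * (s * u))
        ≈⟨ solve 3 (λ D s u → D :* ((s :* u) :* (s :* u)) := (D :* u) :* ((s :* s) :* u))
             refl (d + d) s u ⟩
      ((d + d) * u) * ((s * s) * u)       ≈⟨ *-cong Du≈1 (*-congʳ s²≈aD) ⟩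
      1# * ((a * (d + d)) * u)            ≈⟨ trans (*-identityˡ _) (*-assoc a _ u) ⟩
      a * ((d + d) * u)                   ≈⟨ trans (*-congˡ Du≈1) (*-identityʳ a) ⟩
      a                                   ∎)
    where open SetoidReasoning setoid

  ones : ∀ {n} → Fin n → Carrier
  ones _ = 1#

  embed : ∀ {a n r} {d : Fin n → Carrier} → SameSign a d r → (Fin r → Carrier) → Fin n → Carrier
  embed (take 0<ad₀ s) y zero    = proj₁ (rescale 0<ad₀) * y zero
  embed (take _ s)     y (suc l) = embed s (y ∘ suc) l
  embed (skip _ s)     y zero    = 0#
  embed (skip _ s)     y (suc l) = embed s y l

  -- A selected coordinate contributes `2 d t² = a` times its squared difference, a skipped one
  -- contributes zero. The form is doubled so that `rescale` applies without a division by 2.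
  form-embed : ∀ {a n r} {d : Fin n → Carrier} (s : SameSign a d r) (y y′ : Fin r → Carrier) →
    let w = embed s y ⊝ embed s y′ in form d w w + form d w w ≈ a * form ones (y ⊝ y′) (y ⊝ y′)
  form-embed {a} [] y y′ = solve 1 (λ a → con (+ 0) :+ con (+ 0) := a :* con (+ 0)) refl a
  form-embed {a} {d = d} (take 0<ad₀ s) y y′ = trans
    (solve 5 (λ d t y y′ F →
        (d :* ((t :* y :- t :* y′) :* (t :* y :- t :* y′)) :+ F)
          :+ (d :* ((t :* y :- t :* y′) :* (t :* y :- t :* y′)) :+ F)
        := ((d :+ d) :* (t :* t)) :* ((y :- y′) :* (y :- y′)) :+ (F :+ F)) refl
      (d zero) t (y zero) (y′ zero) _)
    (trans (+-cong (*-cong dt²≈a (sym (*-identityˡ _))) (form-embed s (y ∘ suc) (y′ ∘ suc)))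
      (sym (distribˡ a _ _)))
    where
    t : Carrier
    t = proj₁ (rescale 0<ad₀)

    dt²≈a : (d zero + d zero) * (t * t) ≈ a
    dt²≈a = proj₂ (rescale 0<ad₀)
  form-embed {a} {d = d} (skip _ s) y y′ = trans
    (solve 2 (λ d F →
        (d :* ((con (+ 0) :- con (+ 0)) :* (con (+ 0) :- con (+ 0))) :+ F)
          :+ (d :* ((con (+ 0) :- con (+ 0)) :* (con (+ 0) :- con (+ 0))) :+ F)
        := F :+ F)
      refl (d zero) _)
    (form-embed s y y′)

-- The regular simplex in Euclidean space and its image.

module Simplex {c ℓ₁ ℓ₂} (ℝ : CompleteOrderedField c ℓ₁ ℓ₂) where
  open CompleteOrderedField ℝ hiding (zero)
  open OrderedField ℝ
  open Coordinates commutativeRing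
  open DiagonalForm ℝ
  open IntegerSolver commutativeRing using (solve; con; _:=_; _:+_; _:*_; _:-_; :-_)
  open Sum semiring using (sum; sum-cong-≋; *-distribʳ-sum)
  open SetoidReasoning setoid

  form-ones-δ : ∀ {n} (i : Fin n) (x : Fin n → Carrier) → form ones (δ i) x ≈ x i
  form-ones-δ {n} i x = trans (sum-cong-≋ {n} λ l → *-identityˡ _) (sum-δ i x)

  form-ones-const : ∀ {n} (v : Carrier) → form {n} ones (λ _ → v) (λ _ → v) ≈ sum {n} ones * (v * v)
  form-ones-const {n} v = sym (*-distribʳ-sum {n} (v * v) ones)

  dist² : ∀ {n} → (Fin n → Carrier) → (Fin n → Carrier) → Carrier
  dist² x y = form ones (x ⊝ y) (x ⊝ y)

  dist²-sym : ∀ {n} (x y : Fin n → Carrier) → dist² x y ≈ dist² y x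
  dist²-sym x y = sum-cong-≋ λ l → *-congˡ
    (solve 2 (λ x y → (x :- y) :* (x :- y) := (y :- x) :* (y :- x)) refl (x l) (y l))

  dist²-δ : ∀ {n} (i : Fin n) (x : Fin n → Carrier) →
            dist² (δ i) x ≈ 1# + form ones x x - (x i + x i)
  dist²-δ i x = trans (form-⊝ ones (δ i) x)
    (+-cong (+-congʳ (trans (form-ones-δ i (δ i)) (δ-refl i)))
      (-‿cong (+-cong (form-ones-δ i x) (form-ones-δ i x))))

  -- The natural number `n` as an element of the field, in the shape in which `form-ones-const`
  -- produces it.
  ν : ℕ → Carrier
  ν n = sum {n} ones

  ν-nonneg : ∀ n → 0# ≤ ν n
  ν-nonneg zero    = inj₂ refl
  ν-nonneg (suc n) = +-nonneg (inj₁ 0<1) (ν-nonneg n)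

  -- The root v = −1/(1 + √(1 + n)) of n v² − 2 v = 1 needs no division by n.
  apex : ∀ n → ∃[ v ] ν n * (v * v) - (v + v) ≈ 1#
  apex n =
    let s , 0≤s , s²≈1+ν = sqrt (+-nonneg (inj₁ 0<1) (ν-nonneg n))
        u , [1+s]u≈1     = inverse (1# + s) (pos⇒≉0 (+-pos-nonneg 0<1 0≤s))
    in - u , (begin
      ν n * (- u * - u) - (- u + - u)
        ≈⟨ solve 2 (λ ν u → ν :* (:- u :* :- u) :- (:- u :+ :- u)
             := (con (+ 1) :+ ν) :* (u :* u) :- u :* u :+ (u :+ u)) refl (ν n) u ⟩
      (1# + ν n) * (u * u) - u * u + (u + u)
        ≈⟨ +-congʳ (+-congʳ (*-congʳ s²≈1+ν)) ⟨
      s * s * (u * u) - u * u + (u + u)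
        ≈⟨ solve 2 (λ s u → s :* s :* (u :* u) :- u :* u :+ (u :+ u)
             := ((con (+ 1) :+ s) :* u) :* (s :* u) :- ((con (+ 1) :+ s) :* u) :* u :+ (u :+ u))
             refl s u ⟩
      ((1# + s) * u) * (s * u) - ((1# + s) * u) * u + (u + u)
        ≈⟨ +-congʳ (+-cong (*-congʳ [1+s]u≈1) (-‿cong (*-congʳ [1+s]u≈1))) ⟩
      1# * (s * u) - 1# * u + (u + u)
        ≈⟨ solve 2 (λ s u → con (+ 1) :* (s :* u) :- con (+ 1) :* u :+ (u :+ u)
             := (con (+ 1) :+ s) :* u) refl s u ⟩
      (1# + s) * u
        ≈⟨ [1+s]u≈1 ⟩
      1# ∎)

  simplex : ∀ n → Fin (suc n) → Fin n → Carrier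
  simplex n = (λ _ → proj₁ (apex n)) ∷ δ

  -- With `v` the coordinate of the apex, the squared distance expands to `1 + (n v² - 2v)`, and `v`
  -- was chosen to make the bracket 1.
  dist²-apex : ∀ {n} (i : Fin n) → dist² (δ i) (λ _ → proj₁ (apex n)) ≈ 1# + 1#
  dist²-apex {n} i = trans (dist²-δ i _) (trans (+-assoc _ _ _)
    (+-congˡ (trans (+-congʳ (form-ones-const {n} (proj₁ (apex n)))) (proj₂ (apex n)))))

  simplex-equidistant : ∀ n {i j} → i ≢ j → dist² (simplex n i) (simplex n j) ≈ 1# + 1#
  simplex-equidistant n {zero}  {zero}  i≢j = contradiction ≡.refl i≢j
  simplex-equidistant n {zero}  {suc j} _   = trans (dist²-sym _ (δ j)) (dist²-apex j)
  simplex-equidistant n {suc i} {zero}  _   = dist²-apex i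
  simplex-equidistant n {suc i} {suc j} i≢j = trans (dist²-δ i (δ j))
    (trans (+-cong (+-congˡ (trans (form-ones-δ j (δ j)) (δ-refl j)))
      (-‿cong (+-cong (δ-≢ j≢i) (δ-≢ j≢i))))
      (solve 1 (λ e → e :- (con (+ 0) :+ con (+ 0)) := e) refl (1# + 1#)))
    where
    j≢i : j ≢ i
    j≢i j≡i = i≢j (≡.cong suc (≡.sym j≡i))

  double-injective : ∀ {x y} → x + x ≈ y + y → x ≈ y
  double-injective {x} {y} x+x≈y+y =
    let h , 2h≈1 = inverse (1# + 1#) (pos⇒≉0 (+-pos-nonneg 0<1 (inj₁ 0<1)))
        halve    = λ z → trans
                     (solve 2 (λ z h → (z :+ z) :* h := z :* ((con (+ 1) :+ con (+ 1)) :* h))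
                       refl z h)
                     (trans (*-congˡ 2h≈1) (*-identityʳ z))
    in trans (sym (halve x)) (trans (*-congʳ x+x≈y+y) (halve y))

  module _ {a n r} {d : Fin n → Carrier} (s : SameSign a d r) where

    vertices : Fin (suc r) → Fin n → Carrier
    vertices i = embed s (simplex r i)

    -- The squared distance 2 in the simplex becomes `2a` for the doubled form, and the doubling
    -- then cancels.
    vertices-equidistant : ∀ i j → i ≢ j →
      form d (vertices i ⊝ vertices j) (vertices i ⊝ vertices j) ≈ a
    vertices-equidistant i j i≢j = double-injective
      (trans (form-embed s (simplex r i) (simplex r j))
        (trans (*-congˡ (simplex-equidistant r i≢j))
          (solve 1 (λ a → a :* (con (+ 1) :+ con (+ 1)) := a :+ a) refl a)))

-- Transfer from coordinates to cliques in the vector space.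

module CliqueNumber {c ℓ₁ ℓ₂ m ℓm} (ℝ : CompleteOrderedField c ℓ₁ ℓ₂) (V : VectorSpace ℝ m ℓm)
                    (q : QuadraticForm ℝ V) where
  open CompleteOrderedField ℝ hiding (zero)
  open Module V
  open QuadraticForm q
  open Coordinates commutativeRing using (form; _⊝_)
  open DiagonalForm ℝ using (SameSign; equidistant-bound)
  open Simplex ℝ using (vertices; vertices-equidistant)
  open LeftModuleProperties leftModule using (inverseʳ-uniqueᴹ)
  open AbelianGroupProperties +ᴹ-abelianGroup using (⁻¹-∙-comm; ε⁻¹≈ε)
  open CommutativeSemigroupProperties (CommutativeMonoid.commutativeSemigroup +ᴹ-commutativeMonoid)
    using (interchange)

  lc : ∀ {n} → (Fin n → Carrier) → (Fin n → Carrierᴹ) → Carrierᴹ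
  lc = linearCombination ℝ V

  -‿*ₗ : ∀ x v → (- x) *ₗ v ≈ᴹ -ᴹ (x *ₗ v)
  -‿*ₗ x v = inverseʳ-uniqueᴹ (x *ₗ v) ((- x) *ₗ v)
    (≈ᴹ-trans (≈ᴹ-sym (*ₗ-distribʳ v x (- x))) (≈ᴹ-trans (*ₗ-congʳ (-‿inverseʳ x)) (*ₗ-zeroˡ v)))

  lc-⊝ : ∀ {n} (x y : Fin n → Carrier) (e : Fin n → Carrierᴹ) →
         lc (x ⊝ y) e ≈ᴹ lc x e +ᴹ -ᴹ lc y e
  lc-⊝ {zero}  x y e = ≈ᴹ-sym (≈ᴹ-trans (+ᴹ-identityˡ _) ε⁻¹≈ε)
  lc-⊝ {suc n} x y e = ≈ᴹ-trans
    (+ᴹ-cong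
      (≈ᴹ-trans (*ₗ-distribʳ (e zero) (x zero) (- y zero)) (+ᴹ-congˡ (-‿*ₗ (y zero) (e zero))))
      (lc-⊝ (x ∘ suc) (y ∘ suc) (e ∘ suc)))
    (≈ᴹ-trans (interchange _ _ _ _) (+ᴹ-congˡ (⁻¹-∙-comm _ _)))

  ⟦0ᴹ⟧≈0 : ⟦ 0ᴹ ⟧ ≈ 0#
  ⟦0ᴹ⟧≈0 = trans (⟦⟧-cong (≈ᴹ-sym (*ₗ-zeroˡ 0ᴹ)))
    (trans (homogeneous 0# 0ᴹ) (trans (*-congʳ (zeroˡ 0#)) (zeroˡ _)))

  module _ {n} {e : Fin n → Carrierᴹ} {d : Fin n → Carrier}
           (diagonal : IsDiagonalization ℝ V q e d)
           {a : Carrier} (a≉0 : a ≉ 0#) {r : ℕ} (s : SameSign a d r) where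
    open IsBasis (proj₁ diagonal) using (spanning)

    -- The bridge between coordinates and `q`: it carries the simplex to a clique and, in the other
    -- direction, a clique to an equidistant family.
    form-⟦⟧ : ∀ x y → form d (x ⊝ y) (x ⊝ y) ≈ ⟦ lc x e +ᴹ -ᴹ lc y e ⟧
    form-⟦⟧ x y = trans (sym (proj₂ diagonal (x ⊝ y))) (⟦⟧-cong (lc-⊝ x y e))

    equal⇒⟦⟧≈0 : ∀ {u v} → u ≈ᴹ v → ⟦ u +ᴹ -ᴹ v ⟧ ≈ 0#
    equal⇒⟦⟧≈0 {u} {v} u≈v =
      trans (⟦⟧-cong (≈ᴹ-trans (+ᴹ-congʳ u≈v) (-ᴹ‿inverseʳ v))) ⟦0ᴹ⟧≈0

    simplex-clique : Clique (𝒢 ℝ V q a) (suc r)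
    simplex-clique = record
      { vertex   = vertex
      ; distinct = λ {i} {j} vᵢ≈vⱼ → decidable-stable (i ≟ᶠ j) λ i≢j → ≉ i≢j vᵢ≈vⱼ
      ; adjacent = λ i j i≢j → ≉ i≢j , at-distance i≢j
      }
      where
      vertex : Fin (suc r) → Carrierᴹ
      vertex i = lc (vertices s i) e

      at-distance : ∀ {i j} → i ≢ j → ⟦ vertex i +ᴹ -ᴹ vertex j ⟧ ≈ a
      at-distance {i} {j} i≢j = trans (sym (form-⟦⟧ (vertices s i) (vertices s j)))
        (vertices-equidistant s i j i≢j)

      -- Coinciding vertices would have a difference of value `⟦ 0ᴹ ⟧ ≈ 0#`, whereas it is `a`,
      -- which is nonzero.
      ≉ : ∀ {i j} → i ≢ j → ¬ vertex i ≈ᴹ vertex j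
      ≉ i≢j vᵢ≈vⱼ = a≉0 (trans (sym (at-distance i≢j)) (equal⇒⟦⟧≈0 vᵢ≈vⱼ))

    -- Coordinates of the vertices, supplied by `spanning`, form an equidistant family for the
    -- diagonal form, so `equidistant-bound` applies.
    clique-bound : ∀ k → Clique (𝒢 ℝ V q a) k → k ℕ.≤ suc r
    clique-bound k clique = ℕ.≮⇒≥ (equidistant-bound a≉0 s C λ i j i≢j →
      trans (form-⟦⟧ (C i) (C j))
        (trans (⟦⟧-cong (+ᴹ-cong (C-vertex i) (-ᴹ‿cong (C-vertex j)))) (proj₂ (adjacent i j i≢j))))
      where
      open Clique clique

      C : Fin k → Fin n → Carrier
      C i = proj₁ (spanning (vertex i))

      C-vertex : ∀ i → lc (C i) e ≈ᴹ vertex i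
      C-vertex i = proj₂ (spanning (vertex i))

    isCliqueNumber : IsCliqueNumber (𝒢 ℝ V q a) (r ℕ.+ 1)
    isCliqueNumber = ≡.subst (IsCliqueNumber (𝒢 ℝ V q a)) (ℕ.+-comm 1 r)
      (simplex-clique , clique-bound)

theorem5p6 : ∀ {c ℓ₁ ℓ₂ m ℓm : Level}
    (ℝ : CompleteOrderedField c ℓ₁ ℓ₂) (V : VectorSpace ℝ m ℓm) →
    let open CompleteOrderedField ℝ in
    FiniteDimensional ℝ V →
    (a : Carrier) → a ≉ 0# →
    (q : QuadraticForm ℝ V) → NonDegenerate ℝ V q →
    (r₊ r₋ : ℕ) → HasSignature ℝ V q r₊ r₋ →
    (0# < a → IsCliqueNumber (𝒢 ℝ V q a) (r₊ ℕ.+ 1)) ×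
    (a < 0# → IsCliqueNumber (𝒢 ℝ V q a) (r₋ ℕ.+ 1))
theorem5p6 ℝ V _ a a≉0 q _ _ _ (n , e , d , diagonal , ≡.refl , ≡.refl) =
    -- The sign of `a` decides which count of the signature is the number of entries `x` of `d` with
    -- `0# < a * x`: the positive entries for `a > 0`, the negative ones for `a < 0`.
    (λ 0<a → isCliqueNumber diagonal a≉0 (sameSign-count (λ x → 0# <? x)
      (λ 0<x → *-pos _ _ 0<a 0<x)
      (λ 0≮x → *-nonneg-nonpos (inj₁ 0<a) (≮⇒≥ 0≮x)) d))
  , (λ a<0 → isCliqueNumber diagonal a≉0 (sameSign-count (λ x → x <? 0#)
      (λ x<0 → *-neg-neg a<0 x<0)
      (λ x≮0 → *-neg-nonneg a<0 (≮⇒≥ x≮0)) d))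
  where
  open CompleteOrderedField ℝ
  open OrderedField ℝ
  open DiagonalForm ℝ
  open CliqueNumber ℝ V q
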